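{- Suppose that $L$ is locally operable and $(L,(f^\sharp)_{f\in E},F)$ is the corresponding partially pre-endomorphic Laver table. Then $(L,(f^\sharp)_{f\in E},F)$ is partially endomorphic if and only if for all $f,g\in E$ of arities $m$ and $n$ respectively, and all $\ell_1,\dots,\ell_m,u_1,\dots,u_n\in L$, $\mathrm{rank}(g,u_1,\dots,u_n)=0$ implies that $$\mathrm{rank}(g,f^\sharp(\ell_1,\dots,\ell_m,u_1),\dots,f^\sharp(\ell_1,\dots,\ell_m,u_n))=0.$$
   Context: Setting. $E,F$ are disjoint sets of function symbols, each $f\in E\cup F$ of arity $n_f$; $X$ is a set of variables. For $f\in E$, $x\in X$ let $f_x$ be a function symbol of arity $n_f$, and $\mathcal{G}=\{f_x\mid f\in E,x\in X\}\cup F$. $\mathbf{T}_{\mathcal{G}}(X)$ is the set of terms over $\mathcal{G}$ with variables in $X$, ordered by the subterm relation $\preceq$. $L\subseteq\mathbf{T}_{\mathcal{G}}(X)$ satisfies: $L$ is downwards closed under $\preceq$; $X\subseteq L$; $f_x(\ell_1,\dots,\ell_n)\in L$ iff $f_y(\ell_1,\dots,\ell_n)\in L$ for $x,y\in X$; and if $\mathfrak{g}\in F$ and $\ell_1,\dots,\ell_n\in L$ then $\mathfrak{g}(\ell_1,\dots,\ell_n)\in L$. Ranks. Let $\Omega=\{(f,\ell_1,\dots,\ell_{n_f})\mid f\in E,\ \ell_i\in L\}$. By transfinite recursion some elements of $\Omega$ get an ordinal rank, and $f^\sharp(\ell_1,\dots,\ell_{n_f},\ell)\in L$ is defined for all $\ell\in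 L$ as soon as $(f,\ell_1,\dots,\ell_{n_f})$ has a rank. If $f_x(\ell_1,\dots,\ell_{n_f})\notin L$, then $(f,\ell_1,\dots,\ell_{n_f})$ has rank $0$ and $f^\sharp(\ell_1,\dots,\ell_{n_f},\ell)=\ell$. For $\alpha>0$ and $w=(g,\ell_1,\dots,\ell_n)\in\Omega$ with no rank $<\alpha$, define a partial function $Q:L\to L$ by recursion on $\ell$: (i) $Q(x)=g_x(\ell_1,\dots,\ell_n)$ for $x\in X$; (ii) $Q(\mathfrak{f}(u_1,\dots,u_m))=\mathfrak{f}(Q(u_1),\dots,Q(u_m))$ for $\mathfrak{f}\in F$ if all $Q(u_i)$ are defined; (iii) $Q(f_x(u_1,\dots,u_m))=f^\sharp(Q(u_1),\dots,Q(u_m),g_x(\ell_1,\dots,\ell_n))$ for $f\in E$ if all $Q(u_i)$ are defined and $(f,Q(u_1),\dots,Q(u_m))$ has rank $<\alpha$; otherwise undefined. If $Q$ is total, $w$ has rank $\alpha$ and $g^\sharp(\ell_1,\dots,\ell_n,\ell)=Q(\ell)$. $L$ is operable if every element of $\Omega$ has a rank; then each $g^\sharp:L^{n_g+1}\to L$ is total. Locally operable. For finite $Y\subseteq X$, $U\subseteq E$, $V\subseteq F$ let $\mathcal{G}_{Y,U,V}=\{f_y\mid f\in U,y\in Y\}\cup V$ and $L_{Y,U,V}=\mathbf{T}_{\mathcal{G}_{Y,U,V}}(Y)\cap L$. $L$ is locally operable if all $L_{Y,U,V}$ are operable (with $Y,U,V$ in place of $X,E,F$). Then the operations $g^\sharp$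 of the sets $L_{Y,U,V}$ are restrictions of operations $g^\sharp:L^{n_g+1}\to L$ ($g\in E$), and $(L,(g^\sharp)_{g\in E},F)$, where symbols of $F$ act as term formation, is called a partially pre-endomorphic Laver table. In this setting $\mathrm{rank}(g,u_1,\dots,u_n)=0$ means $g_x(u_1,\dots,u_n)\notin L$. Partially endomorphic means: for all $f\in E$ and $\ell_1,\dots,\ell_{n_f}\in L$, the map $\ell\mapsto f^\sharp(\ell_1,\dots,\ell_{n_f},\ell)$ is an endomorphism of the algebra $(L,(g^\sharp)_{g\in E},F)$. -}

module Defs where

open import Level using (0ℓ)
open import Data.List using (List)
import Data.List.Membership.Propositional as List
open import Data.Nat using (ℕ)
open import Data.Product using (∃; ∃-syntax; _×_)
open import Data.Sum using (_⊎_)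
open import Data.Vec using (Vec; map)
open import Data.Vec.Membership.Propositional using (_∈_)
open import Data.Vec.Relation.Unary.All using (All)
open import Data.Vec.Relation.Binary.Pointwise.Inductive using (Pointwise)
open import Function.Bundles using (_⇔_)
open import Relation.Binary.PropositionalEquality using (_≡_)
open import Relation.Nullary using (¬_)
open import Relation.Unary using (Pred; _∩_)

-- Ordinals as well-founded trees: sup I a is the least ordinal strictly above
-- all a i, so the ordinals below it are those ≤ a i for some i.  Different
-- trees may denote the same ordinal.
data Ord : Set₁ where
  sup : (I : Set) (a : I → Ord) → Ord

IsPositive : Ord → Set
IsPositive (sup I a) = I

IsZero : Ord → Set
IsZero α = ¬ IsPositive α

-- E and F are separate types, hence disjoint as sets of symbols.
record Signature : Set₁ where
  field
    E F : Set
    arityE : E → ℕ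
    arityF : F → ℕ

module Terms (Sg : Signature) (X : Set) where
  open Signature Sg public

  -- The symbol f_x is written f ₍ x ₎.
  data 𝒢 : Set where
    _₍_₎ : E → X → 𝒢
    fn   : F → 𝒢

  arity : 𝒢 → ℕ
  arity (f ₍ x ₎) = arityE f
  arity (fn h)    = arityF h

  data Term : Set where
    var  : X → Term
    node : (s : 𝒢) → Vec Term (arity s) → Term

  infix 4 _≼_
  data _≼_ : Term → Term → Set where
    here  : ∀ {t} → t ≼ t
    below : ∀ {r t s ts} → t ∈ ts → r ≼ t → r ≼ node s ts

  record Admissible (L : Pred Term 0ℓ) : Set where
    field
      ≼-closed     : ∀ {s t} → s ≼ t → L t → L s
      variables    : ∀ x → L (var x)
      exchangeable : ∀ f x y ls →
                    L (node (f ₍ x ₎) ls) ⇔ L (node (f ₍ y ₎) ls)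
      F-closed     : ∀ h ls → All L ls → L (node (fn h) ls)

  module _ (Y : Pred X 0ℓ) (U : Pred E 0ℓ) (V : Pred F 0ℓ) where

    data 𝒢⟨_,_,_⟩ : Pred 𝒢 0ℓ where
      sub : ∀ {f y} → U f → Y y → 𝒢⟨_,_,_⟩ (f ₍ y ₎)
      fn  : ∀ {h} → V h → 𝒢⟨_,_,_⟩ (fn h)

    data T⟨_,_,_⟩ : Pred Term 0ℓ where
      var  : ∀ {y} → Y y → T⟨_,_,_⟩ (var y)
      node : ∀ {s ts} → 𝒢⟨_,_,_⟩ s → All T⟨_,_,_⟩ ts → T⟨_,_,_⟩ (node s ts)

  -- Ranks for the set M = T_{𝒢_{Y,U,V}}(Y) ∩ L, with Y, U, V in the roles of
  -- X, E, F.
  module Ranks (L : Pred Term 0ℓ)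
               (Y : Pred X 0ℓ) (U : Pred E 0ℓ) (V : Pred F 0ℓ) where

    M : Pred Term 0ℓ
    M = T⟨ Y , U , V ⟩ ∩ L

    Ω : (g : E) → Pred (Vec Term (arityE g)) 0ℓ
    Ω g ls = U g × All M ls

    -- A partial system of operations: ranked g ls says that (g , ls) has been
    -- given a rank, and value g ls ℓ r that moreover g♯(ls , ℓ) = r.
    record Stage : Set₁ where
      field
        ranked : (g : E) → Vec Term (arityE g) → Set
        value  : (g : E) → Vec Term (arityE g) → Term → Term → Set
    open Stage

    -- Graph of the partial function Q attached to (g , ls), when S collects
    -- the ranks and operations obtained so far.
    data Q (S : Stage) (g : E) (ls : Vec Term (arityE g)) :
           Term → Term → Set where
      Q-var : ∀ {x} → Q S g ls (var x) (node (g ₍ x ₎) ls)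
      Q-F   : ∀ {h us vs} → Pointwise (Q S g ls) us vs →
              Q S g ls (node (fn h) us) (node (fn h) vs)
      Q-E   : ∀ {f x us vs r} → Pointwise (Q S g ls) us vs →
              value S f vs (node (g ₍ x ₎) ls) r →
              Q S g ls (node (f ₍ x ₎) us) r

    data HasRank (α : Ord) (S : Stage) (g : E) (ls : Vec Term (arityE g)) :
                 Set where
      rank-zero : IsZero α → Ω g ls →
                  (∀ x → Y x → ¬ M (node (g ₍ x ₎) ls)) →
                  HasRank α S g ls
      rank-pos  : IsPositive α → Ω g ls → ¬ ranked S g ls →
                  (∀ ℓ → M ℓ → ∃[ r ] Q S g ls ℓ r) →
                  HasRank α S g ls

    -- stage< α comprises everything of rank < α, and stage α everything of
    -- rank exactly α.  A rank below sup I a is either some a i or below it.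
    stage< : Ord → Stage
    stage  : Ord → Stage

    stage< (sup I a) = record
      { ranked = λ g ls → ∃[ i ] (ranked (stage< (a i)) g ls ⊎
                                  ranked (stage  (a i)) g ls)
      ; value  = λ g ls ℓ r → ∃[ i ] (value (stage< (a i)) g ls ℓ r ⊎
                                      value (stage  (a i)) g ls ℓ r)
      }

    stage α@(sup _ _) = record
      { ranked = HasRank α (stage< α)
      ; value  = λ g ls ℓ r → HasRank α (stage< α) g ls × M ℓ ×
                   ((IsZero α × r ≡ ℓ) ⊎ (IsPositive α × Q (stage< α) g ls ℓ r))
      }

    Operable : Set₁
    Operable = ∀ g ls → Ω g ls → ∃[ α ] ranked (stage α) g ls

    -- The graph of g♯ on M.
    Sharp : (g : E) → Vec Term (arityE g) → Term → Term → Set₁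
    Sharp g ls ℓ r = ∃[ α ] value (stage α) g ls ℓ r

  -- Finite subsets are given by lists; only membership in them matters.
  module FiniteRanks (L : Pred Term 0ℓ)
                     (Y : List X) (U : List E) (V : List F) =
    Ranks L (List._∈ Y) (List._∈ U) (List._∈ V)

  LocallyOperable : Pred Term 0ℓ → Set₁
  LocallyOperable L = ∀ Y U V → FiniteRanks.Operable L Y U V

  -- An operation L^{n+1} → L for every symbol of E of arity n is represented
  -- by a function on all terms, whose values outside L are never used.
  Operations : Set
  Operations = (g : E) → Vec Term (arityE g) → Term → Term

  record IsPreEndomorphicLaverTable (L : Pred Term 0ℓ) (♯ : Operations) :
                                    Set₁ where
    field
      closed    : ∀ g ls ℓ → All L ls → L ℓ → L (♯ g ls ℓ)
      restricts : ∀ Y U V → let open FiniteRanks L Y U V in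
                  ∀ g ls ℓ → Ω g ls → M ℓ → Sharp g ls ℓ (♯ g ls ℓ)

  record IsEndomorphism (L : Pred Term 0ℓ) (♯ : Operations) (φ : Term → Term) :
                        Set where
    field
      preserves-L : ∀ u → L u → L (φ u)
      preserves-♯ : ∀ g us u → All L us → L u →
                    φ (♯ g us u) ≡ ♯ g (map φ us) (φ u)
      preserves-F : ∀ h us → All L us →
                    φ (node (fn h) us) ≡ node (fn h) (map φ us)

  PartiallyEndomorphic : Pred Term 0ℓ → Operations → Set
  PartiallyEndomorphic L ♯ =
    ∀ f ls → All L ls → IsEndomorphism L ♯ (♯ f ls)

  -- rank(g , us) = 0.  Since membership of g_x(us) in L is independent of x,
  -- the quantifier only matters when X is empty; then every rank is 0.
  RankZero : Pred Term 0ℓ → (g : E) → Vec Term (arityE g) → Set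
  RankZero L g us = ∀ x → ¬ L (node (g ₍ x ₎) us)

{-# OPTIONS --safe #-}
-- Fix finite Y, U, V with some x in Y.  On M = L_{Y,U,V} an element of positive rank satisfies
--   g♯(us, x) = g_x(us),  g♯(us, k_x(vs)) = k♯(g♯(us, vs), g_x(us)),
-- and the ranks only matter through one well-founded relation:
-- (g, f♯(ls, us)) lies below (f, ls) whenever f_x(ls), g_x(us) ∈ L.
--
-- (⇐) With φ = f♯(ls, ·), ψ = g♯(us, ·), ψ′ = g♯(φ us, ·), the identity φ ∘ ψ = ψ′ ∘ φ at k_x(vs)
-- reduces to φ distributing over k♯(ψ vs, ·), where (k, ψ vs) is below (g, us), to the identity at vs,
-- and to ψ′ distributing over k♯(φ vs, ·), where (g, φ us) is below (f, ls).
--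
-- (⇒) If (g, vs) has positive rank, then g♯(vs, t) contains some g_y(vs) as a subterm unless t is built
-- from F alone.  If (g, us) has rank 0 but (g, vs) with vs = φ us does not, the endomorphism φ gives
-- f_x(ls) = φ(g♯(us, x)) = g♯(vs, f_x(ls)), which contains g_y(vs), hence properly contains some φ(u),
-- which in turn contains some f_z(ls): impossible, as f_z(ls) is as large as f_x(ls).
module Submission where

open import Level using (0ℓ; lift; lower) renaming (suc to lsuc)
open import Axiom.ExcludedMiddle using (ExcludedMiddle)
open import Data.Empty using (⊥; ⊥-elim)
open import Data.List as List using (List)
open import Data.List.Membership.Propositional.Properties using (∈-++⁺ˡ; ∈-++⁺ʳ)
import Data.List.Membership.Propositional as List
import Data.List.Relation.Unary.Any as ListAny
open import Data.Nat using (ℕ; suc; _+_; _≤_; s≤s)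
open import Data.Nat.Properties using (≤-refl; ≤-trans; m≤m+n; m≤n+m; m≤n⇒m≤1+n; 1+n≰n)
open import Data.Product using (∃-syntax; _×_; _,_; proj₁; proj₂)
open import Data.Sum using (_⊎_; inj₁; inj₂)
open import Data.Vec using (Vec; []; _∷_; map)
open import Data.Vec.Membership.Propositional using (_∈_)
open import Data.Vec.Membership.Propositional.Properties using (∈-lookup)
open import Data.Vec.Properties using (map-id)
open import Data.Vec.Relation.Unary.All as All using (All; []; _∷_)
open import Data.Vec.Relation.Unary.All.Properties using (lookup⁻)
open import Data.Vec.Relation.Unary.Any using (here; there)
open import Data.Vec.Relation.Binary.Pointwise.Inductive using (Pointwise; []; _∷_)
open import Function.Base using (_∘_; id)
open import Function.Bundles using (_⇔_; mk⇔; Equivalence)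
open import Relation.Binary.PropositionalEquality
open import Relation.Nullary using (¬_; Dec; yes; no)
open import Relation.Nullary.Decidable using (map′)
open import Relation.Unary using (Pred; _⊆_)
open import Defs

-- Mapping pointwise equal functions over vectors.

map-cong-local : ∀ {A B : Set} {f g : A → B} {n} {xs : Vec A n} →
                 All (λ x → f x ≡ g x) xs → map f xs ≡ map g xs
map-cong-local []       = refl
map-cong-local (p ∷ ps) = cong₂ _∷_ p (map-cong-local ps)

map-id-local : ∀ {A : Set} {f : A → A} {n} {xs : Vec A n} →
               All (λ x → f x ≡ x) xs → map f xs ≡ xs
map-id-local ps = trans (map-cong-local {g = id} ps) (map-id _)

-- Size, subterms and finite supports of terms.

module TermProperties (Sg : Signature) (X : Set) where
  open Terms Sg X

  -- The index x of f_x is ignored, so f_x(ls) and f_z(ls) have the same size by definition.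
  size  : Term → ℕ
  sizes : ∀ {n} → Vec Term n → ℕ
  size (var x)     = 0
  size (node s ts) = suc (sizes ts)
  sizes []       = 0
  sizes (t ∷ ts) = size t + sizes ts

  ∈⇒size≤sizes : ∀ {n t} {ts : Vec Term n} → t ∈ ts → size t ≤ sizes ts
  ∈⇒size≤sizes (here refl)           = m≤m+n _ _
  ∈⇒size≤sizes {ts = u ∷ _} (there i) = ≤-trans (∈⇒size≤sizes i) (m≤n+m _ (size u))

  ≼⇒size≤ : ∀ {s t} → s ≼ t → size s ≤ size t
  ≼⇒size≤ here        = ≤-refl
  ≼⇒size≤ (below i p) = ≤-trans (≼⇒size≤ p) (m≤n⇒m≤1+n (∈⇒size≤sizes i))

  ≼-trans : ∀ {r s t} → r ≼ s → s ≼ t → r ≼ t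
  ≼-trans p here        = p
  ≼-trans p (below i q) = below i (≼-trans p q)

  -- Variable-free terms over F, with the constants of F as base case. Every g♯(ls, ·) fixes them,
  -- so they are the exceptions in `♯-contains`.
  data FTerm : Pred Term 0ℓ where
    node : ∀ {h ts} → All FTerm ts → FTerm (node (fn h) ts)

  module _ {Y Y′ : Pred X 0ℓ} {U U′ : Pred E 0ℓ} {V V′ : Pred F 0ℓ}
           (Y⊆ : Y ⊆ Y′) (U⊆ : U ⊆ U′) (V⊆ : V ⊆ V′) where
    T-mono  : T⟨ Y , U , V ⟩ ⊆ T⟨ Y′ , U′ , V′ ⟩
    Ts-mono : ∀ {n} {ts : Vec Term n} → All T⟨ Y , U , V ⟩ ts → All T⟨ Y′ , U′ , V′ ⟩ ts
    T-mono (var y)             = var (Y⊆ y)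
    T-mono (node (sub u y) ts) = node (sub (U⊆ u) (Y⊆ y)) (Ts-mono ts)
    T-mono (node (fn v) ts)    = node (fn (V⊆ v)) (Ts-mono ts)
    Ts-mono []       = []
    Ts-mono (t ∷ ts) = T-mono t ∷ Ts-mono ts

  Tfin : List X → List E → List F → Pred Term 0ℓ
  Tfin Y U V = T⟨ List._∈ Y , List._∈ U , List._∈ V ⟩

  -- Reduces claims about finitely many elements of `L` to a single L_{Y,U,V}.
  finite-support  : ∀ t → ∃[ Y ] ∃[ U ] ∃[ V ] Tfin Y U V t
  finite-supports : ∀ {n} (ts : Vec Term n) → ∃[ Y ] ∃[ U ] ∃[ V ] All (Tfin Y U V) ts
  finite-support (var x) = x List.∷ List.[] , List.[] , List.[] , var (ListAny.here refl)
  finite-support (node (f ₍ x ₎) ts) with finite-supports ts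
  ... | Y , U , V , ps = x List.∷ Y , f List.∷ U , V ,
        node (sub (ListAny.here refl) (ListAny.here refl)) (Ts-mono ListAny.there ListAny.there id ps)
  finite-support (node (fn h) ts) with finite-supports ts
  ... | Y , U , V , ps = Y , U , h List.∷ V ,
        node (fn (ListAny.here refl)) (Ts-mono id id ListAny.there ps)
  finite-supports [] = List.[] , List.[] , List.[] , []
  finite-supports (t ∷ ts) with finite-support t | finite-supports ts
  ... | Y , U , V , p | Y′ , U′ , V′ , ps =
        Y List.++ Y′ , U List.++ U′ , V List.++ V′ ,
        T-mono ∈-++⁺ˡ ∈-++⁺ˡ ∈-++⁺ˡ p ∷ Ts-mono (∈-++⁺ʳ Y) (∈-++⁺ʳ U) (∈-++⁺ʳ V) ps

-- The table and closure properties of `L`.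

module LaverTable (em : ExcludedMiddle (lsuc 0ℓ)) (Sg : Signature) (X : Set)
                  (L : Pred (Terms.Term Sg X) 0ℓ) (adm : Terms.Admissible Sg X L)
                  (♯ : Terms.Operations Sg X)
                  (table : Terms.IsPreEndomorphicLaverTable Sg X L ♯) where
  open Terms Sg X
  open TermProperties Sg X
  open Admissible adm
  open IsPreEndomorphicLaverTable table

  dec : (P : Set) → Dec P
  dec P = map′ lower (lift {ℓ = lsuc 0ℓ}) em

  L-args : ∀ {s ts} → L (node s ts) → All L ts
  L-args l = lookup⁻ λ i → ≼-closed (below (∈-lookup i _) here) l

  L-exchange : ∀ {f x ls} y → L (node (f ₍ x ₎) ls) → L (node (f ₍ y ₎) ls)
  L-exchange y = Equivalence.to (exchangeable _ _ y _)

  PreservesRankZero : Set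
  PreservesRankZero = ∀ (f g : E) (ls : Vec Term (arityE f)) (us : Vec Term (arityE g)) →
                      All L ls → All L us → RankZero L g us → RankZero L g (map (♯ f ls) us)

  -- Ranks inside a finite part M = L_{Y,U,V}.

  module Local (Y : List X) (U : List E) (V : List F) where
    open FiniteRanks L Y U V public
    open Stage

    M-args : ∀ {s ts} → M (node s ts) → All M ts
    M-args (node _ ts , l) = All.zip (ts , L-args l)

    M-Ω : ∀ {f x ls} → M (node (f ₍ x ₎) ls) → Ω f ls
    M-Ω m@(node (sub u _) _ , _) = u , M-args m

    M-F : ∀ {h ts vs} → M (node (fn h) ts) → All M vs → M (node (fn h) vs)
    M-F (node (fn v) _ , _) ms = node (fn v) (proj₁ (All.unzip ms)) , F-closed _ _ (proj₂ (All.unzip ms))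

    M-exchange : ∀ {f x ls y} → y List.∈ Y → M (node (f ₍ x ₎) ls) → M (node (f ₍ y ₎) ls)
    M-exchange {y = y} i (node (sub u _) ts , l) = node (sub u i) ts , L-exchange y l

    M-var : ∀ {f x ls} → M (node (f ₍ x ₎) ls) → M (var x)
    M-var (node (sub _ i) _ , _) = var i , variables _

    -- Rank 0 as seen by `M`. For (g, ls) in Ω and inhabited Y it agrees with `RankZero L`.
    LocallyZero : (g : E) → Vec Term (arityE g) → Set
    LocallyZero g ls = ∀ x → x List.∈ Y → ¬ M (node (g ₍ x ₎) ls)

    zero-or-positive : ∀ g ls → LocallyZero g ls ⊎ ∃[ x ] M (node (g ₍ x ₎) ls)
    zero-or-positive g ls with dec (∃[ x ] M (node (g ₍ x ₎) ls))
    ... | yes p = inj₂ p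
    ... | no ¬p = inj₁ λ x _ m → ¬p (x , m)

    -- Descend along a branch of the tree: each child is either zero, and gives the rank there, or
    -- positive, and the descent goes on.
    zero-below : ∀ α {g ls} → IsPositive α → Ω g ls → LocallyZero g ls → ranked (stage< α) g ls
    zero-below (sup I a) {g} {ls} i ω z = i , at (a i) refl
      where
      -- Matching on a copy β of `a i` lets `stage β` compute, while the recursive call stays on the
      -- visibly smaller `a i`.
      at : ∀ β → β ≡ a i → ranked (stage< (a i)) g ls ⊎ ranked (stage (a i)) g ls
      at (sup J b) eq with dec J
      ... | yes j = inj₁ (zero-below (a i) (subst IsPositive eq j) ω z)
      ... | no ¬j = inj₂ (subst (λ β → ranked (stage β) g ls) eq (rank-zero ¬j ω z))

    value⇒ranked : ∀ α {g ls ℓ r} → value (stage α) g ls ℓ r → ranked (stage α) g ls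
    value⇒ranked (sup I a) (h , _) = h

    value<⇒ranked< : ∀ α {g ls ℓ r} → value (stage< α) g ls ℓ r → ranked (stage< α) g ls
    value<⇒ranked< (sup I a) (i , inj₁ v) = i , inj₁ (value<⇒ranked< (a i) v)
    value<⇒ranked< (sup I a) (i , inj₂ v) = i , inj₂ (value⇒ranked (a i) v)

    value<⇒Sharp : ∀ α {g ls ℓ r} → value (stage< α) g ls ℓ r → Sharp g ls ℓ r
    value<⇒Sharp (sup I a) (i , inj₁ v) = value<⇒Sharp (a i) v
    value<⇒Sharp (sup I a) (i , inj₂ v) = a i , v

    -- By `zero-below` an element of rank 0 is already ranked below α, which `rank-pos` forbids.
    positive⇒¬zero : ∀ α {g ls} → IsPositive α → HasRank α (stage< α) g ls → ¬ LocallyZero g ls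
    positive⇒¬zero α p (rank-zero n _ _)  z = n p
    positive⇒¬zero α p (rank-pos _ ω n _) z = n (zero-below α p ω z)

    zero⇒LocallyZero : ∀ {α S g ls} → IsZero α → HasRank α S g ls → LocallyZero g ls
    zero⇒LocallyZero n (rank-zero _ _ z)  = z
    zero⇒LocallyZero n (rank-pos p _ _ _) = ⊥-elim (n p)

    -- Values do not depend on the ordinal at which they are computed.

    module _ {S S′ : Stage}
             (functional : ∀ {g ls ℓ r r′} → value S g ls ℓ r → value S′ g ls ℓ r′ → r ≡ r′) where
      Q-functional  : ∀ {g ls ℓ r r′} → Q S g ls ℓ r → Q S′ g ls ℓ r′ → r ≡ r′
      Qs-functional : ∀ {g ls n} {us vs vs′ : Vec Term n} →
                      Pointwise (Q S g ls) us vs → Pointwise (Q S′ g ls) us vs′ → vs ≡ vs′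
      Q-functional Q-var      Q-var        = refl
      Q-functional (Q-F q)    (Q-F q′)     = cong (node (fn _)) (Qs-functional q q′)
      Q-functional (Q-E q v)  (Q-E q′ v′) with refl ← Qs-functional q q′ = functional v v′
      Qs-functional []       []         = refl
      Qs-functional (q ∷ qs) (q′ ∷ qs′) = cong₂ _∷_ (Q-functional q q′) (Qs-functional qs qs′)

    -- Induction on the first ordinal only; the second is arbitrary, so different trees for one
    -- ordinal are covered too. Mixed zero and positive cases are refuted by `positive⇒¬zero`.
    value-functional  : ∀ α {g ls ℓ r r′} → value (stage α) g ls ℓ r → Sharp g ls ℓ r′ → r ≡ r′
    value<-functional : ∀ α {g ls ℓ r r′} → value (stage< α) g ls ℓ r → Sharp g ls ℓ r′ → r ≡ r′
    value-functional (sup I a) (h , _ , inj₁ (_ , refl)) (sup J b , _ , _ , inj₁ (_ , refl)) = refl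
    value-functional (sup I a) (h , _ , inj₁ (n , refl)) (sup J b , h′ , _ , inj₂ (p , _)) =
      ⊥-elim (positive⇒¬zero (sup J b) p h′ (zero⇒LocallyZero n h))
    value-functional (sup I a) (h , _ , inj₂ (p , _)) (sup J b , h′ , _ , inj₁ (n , refl)) =
      ⊥-elim (positive⇒¬zero (sup I a) p h (zero⇒LocallyZero n h′))
    value-functional α@(sup I a) (h , _ , inj₂ (p , q)) (β@(sup J b) , h′ , _ , inj₂ (p′ , q′)) =
      Q-functional {stage< α} {stage< β} (λ v v′ → value<-functional α v (value<⇒Sharp β v′)) q q′
    value<-functional (sup I a) (i , inj₁ v) s = value<-functional (a i) v s
    value<-functional (sup I a) (i , inj₂ v) s = value-functional (a i) v s

    -- The defining equations of g♯ on M.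

    Sharp⇒♯ : ∀ {g ls ℓ r} → Ω g ls → M ℓ → Sharp g ls ℓ r → r ≡ ♯ g ls ℓ
    Sharp⇒♯ ω m (α , v) = value-functional α v (restricts Y U V _ _ _ ω m)

    Q⇒♯ : ∀ α {g ls ℓ r} → HasRank α (stage< α) g ls → IsPositive α → Ω g ls → M ℓ →
          Q (stage< α) g ls ℓ r → r ≡ ♯ g ls ℓ
    Q⇒♯ (sup I a) h p ω m q = Sharp⇒♯ ω m (sup I a , h , m , inj₂ (p , q))

    Qs⇒♯ : ∀ α {g ls n} {us vs : Vec Term n} → HasRank α (stage< α) g ls → IsPositive α → Ω g ls →
           All M us → Pointwise (Q (stage< α) g ls) us vs → vs ≡ map (♯ g ls) us
    Qs⇒♯ α h p ω []       []       = refl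
    Qs⇒♯ α h p ω (m ∷ ms) (q ∷ qs) = cong₂ _∷_ (Q⇒♯ α h p ω m q) (Qs⇒♯ α h p ω ms qs)

    ♯-zero : ∀ {g ls ℓ} → Ω g ls → LocallyZero g ls → M ℓ → ♯ g ls ℓ ≡ ℓ
    ♯-zero ω z m with restricts Y U V _ _ _ ω m
    ... | sup I a , h , _ , inj₁ (_ , eq) = eq
    ... | sup I a , h , _ , inj₂ (p , _)  = ⊥-elim (positive⇒¬zero (sup I a) p h z)

    ♯s-zero : ∀ {g ls n} {ts : Vec Term n} → Ω g ls → LocallyZero g ls → All M ts →
              map (♯ g ls) ts ≡ ts
    ♯s-zero ω z = map-id-local ∘ All.map (♯-zero ω z)

    -- Exhibits the value of `♯` as a value of `Q`; inverting the clauses of `Q` then yields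
    -- `♯-var`, `♯-F` and `♯-E`.
    ♯-positive : ∀ {g x ls ℓ} → M (node (g ₍ x ₎) ls) → M ℓ →
                 ∃[ α ] HasRank α (stage< α) g ls × IsPositive α × Q (stage< α) g ls ℓ (♯ g ls ℓ)
    ♯-positive mg m with restricts Y U V _ _ _ (M-Ω mg) m
    ... | α@(sup I a) , h , _ , inj₂ (p , q) = α , h , p , q
    ... | α@(sup I a) , h , _ , inj₁ (n , _) with M-var mg
    ...   | var i , _ = ⊥-elim (zero⇒LocallyZero n h _ i mg)

    ♯-var : ∀ {g x ls y} → M (node (g ₍ x ₎) ls) → M (var y) → ♯ g ls (var y) ≡ node (g ₍ y ₎) ls
    ♯-var {g} {_} {ls} {y} mg m with ♯ g ls (var y) | ♯-positive mg m
    ... | _ | _ , _ , _ , Q-var = refl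

    ♯-F : ∀ {g ls h us} → Ω g ls → M (node (fn h) us) →
          ♯ g ls (node (fn h) us) ≡ node (fn h) (map (♯ g ls) us)
    ♯-F {g} {ls} {h} {us} ω m with zero-or-positive g ls
    ... | inj₁ z = trans (♯-zero ω z m) (cong (node (fn h)) (sym (♯s-zero ω z (M-args m))))
    ... | inj₂ (_ , mg) with ♯ g ls (node (fn h) us) | ♯-positive mg m
    ...   | _ | α , r , p , Q-F qs = cong (node (fn h)) (Qs⇒♯ α r p ω (M-args m) qs)

    value⇒Ω×M : ∀ α {g ls ℓ r} → value (stage α) g ls ℓ r → Ω g ls × M ℓ
    value⇒Ω×M (sup I a) (rank-zero _ ω _ , m , _)  = ω , m
    value⇒Ω×M (sup I a) (rank-pos _ ω _ _ , m , _) = ω , m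

    ♯-E : ∀ {g x ls f y us} → M (node (g ₍ x ₎) ls) → M (node (f ₍ y ₎) us) →
          ♯ g ls (node (f ₍ y ₎) us) ≡ ♯ f (map (♯ g ls) us) (node (g ₍ y ₎) ls)
    ♯-E {g} {x} {ls} {f} {y} {us} mg m with ♯ g ls (node (f ₍ y ₎) us) | ♯-positive mg m
    ... | _ | α , h , p , Q-E qs v with refl ← Qs⇒♯ α h p (M-Ω mg) (M-args m) qs
                                   with value<⇒Sharp α v
    ... | β , v′ = Sharp⇒♯ (proj₁ (value⇒Ω×M β v′)) (proj₂ (value⇒Ω×M β v′)) (β , v′)

    -- The well-founded relation behind the ranks, and closure of M.

    -- For f_x(ls), g_x(us) ∈ M, f♯(ls, g_x(us)) is only defined once (g, f♯(ls, us)) has a smaller rank.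
    data Founded (f : E) (ls : Vec Term (arityE f)) : Set where
      founded : (∀ {x g y us} → M (node (f ₍ x ₎) ls) → M (node (g ₍ y ₎) us) →
                 Founded g (map (♯ f ls) us)) →
                Founded f ls

    -- Q is total, and its value at g_y(us) can only come from `Q-E`, which demands a smaller rank
    -- for (g, f♯(ls, us)).
    positive⇒ranked< : ∀ α {f x ls g y us} → HasRank α (stage< α) f ls →
                       M (node (f ₍ x ₎) ls) → M (node (g ₍ y ₎) us) →
                       ranked (stage< α) g (map (♯ f ls) us)
    positive⇒ranked< α (rank-zero _ _ z) mf@(node (sub _ i) _ , _) _ = ⊥-elim (z _ i mf)
    positive⇒ranked< α h@(rank-pos p ω _ total) _ m with total _ m
    ... | _ , Q-E qs v with refl ← Qs⇒♯ α h p ω (M-args m) qs = value<⇒ranked< α v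

    ranked⇒Founded  : ∀ α {f ls} → ranked (stage α) f ls → Founded f ls
    ranked<⇒Founded : ∀ α {f ls} → ranked (stage< α) f ls → Founded f ls
    ranked⇒Founded α@(sup I a) h = founded λ mf m → ranked<⇒Founded α (positive⇒ranked< α h mf m)
    ranked<⇒Founded (sup I a) (i , inj₁ r) = ranked<⇒Founded (a i) r
    ranked<⇒Founded (sup I a) (i , inj₂ r) = ranked⇒Founded (a i) r

    -- `closed` only gives values in `L`; here they stay in the same finite part. Lexicographic
    -- induction on `Founded f ls` and the term.
    ♯-M  : ∀ {f ls t} → Founded f ls → Ω f ls → M t → M (♯ f ls t)
    ♯-M′ : ∀ {f ls x} → Founded f ls → M (node (f ₍ x ₎) ls) → ∀ t → M t → M (♯ f ls t)
    ♯s-M : ∀ {f ls x n} → Founded f ls → M (node (f ₍ x ₎) ls) →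
           (ts : Vec Term n) → All M ts → All M (map (♯ f ls) ts)
    ♯-M {f} {ls} a ω m with zero-or-positive f ls
    ... | inj₁ z        = subst M (sym (♯-zero ω z m)) m
    ... | inj₂ (_ , mf) = ♯-M′ a mf _ m
    ♯-M′ a mf (var x) m@(var i , _) = subst M (sym (♯-var mf m)) (M-exchange i mf)
    ♯-M′ a mf (node (fn h) ts) m = subst M (sym (♯-F (M-Ω mf) m)) (M-F m (♯s-M a mf ts (M-args m)))
    ♯-M′ a@(founded preds) mf (node (g ₍ y ₎) ts) m@(node (sub u i) _ , _) =
      subst M (sym (♯-E mf m)) (♯-M (preds mf m) (u , ♯s-M a mf ts (M-args m)) (M-exchange i mf))
    ♯s-M a mf []       []       = []
    ♯s-M a mf (t ∷ ts) (m ∷ ms) = ♯-M′ a mf t m ∷ ♯s-M a mf ts ms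

    -- Occurrences of g_y(vs) in the values of g♯(vs, ·).

    ♯-FTerm  : ∀ {f ls x} t → M (node (f ₍ x ₎) ls) → M t → FTerm t → ♯ f ls t ≡ t
    ♯s-FTerm : ∀ {f ls x n} (ts : Vec Term n) → M (node (f ₍ x ₎) ls) →
               All M ts → All FTerm ts → map (♯ f ls) ts ≡ ts
    ♯-FTerm (node (fn h) ts) mf m (node ps) = trans (♯-F (M-Ω mf) m) (cong (node (fn h)) (♯s-FTerm ts mf (M-args m) ps))
    ♯s-FTerm []       mf []       []       = refl
    ♯s-FTerm (t ∷ ts) mf (m ∷ ms) (p ∷ ps) = cong₂ _∷_ (♯-FTerm t mf m p) (♯s-FTerm ts mf ms ps)

    -- Such an (f, ls) would lie below itself.
    FTerms⇒zero : ∀ {f ls ls′ x} → ls′ ≡ ls → Founded f ls′ → All FTerm ls → M (node (f ₍ x ₎) ls) → ⊥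
    FTerms⇒zero {ls = ls} refl (founded preds) ps m =
      FTerms⇒zero (♯s-FTerm ls m (M-args m) ps) (preds m m) ps m

    Contains : (g : E) → Vec Term (arityE g) → Pred Term 0ℓ
    Contains g vs r = ∃[ y ] node (g ₍ y ₎) vs ≼ r

    ContainsSome : (g : E) → Vec Term (arityE g) → ∀ {n} → Vec Term n → Set
    ContainsSome g vs rs = ∃[ y ] ∃[ r ] r ∈ rs × node (g ₍ y ₎) vs ≼ r

    -- With ψ = g♯(vs, ·): if (k, ψ ts) has rank 0, the value is g_y(vs) itself. Otherwise it
    -- contains some k_z(ψ ts), since g_y(vs) is no `FTerm`, and an argument of that contains some
    -- g_y′(vs), unless all of ts are F-terms, which `FTerms⇒zero` excludes. The induction
    -- hypotheses are passed as arguments.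
    ♯-E-contains : ∀ {g vs x k y ts} → Founded g vs → Founded k (map (♯ g vs) ts) →
                   M (node (g ₍ x ₎) vs) → M (node (k ₍ y ₎) ts) →
                   (∀ {z} → M (node (k ₍ z ₎) (map (♯ g vs) ts)) →
                    FTerm (node (g ₍ y ₎) vs) ⊎
                    Contains k (map (♯ g vs) ts) (♯ k (map (♯ g vs) ts) (node (g ₍ y ₎) vs))) →
                   All FTerm ts ⊎ ContainsSome g vs (map (♯ g vs) ts) →
                   Contains g vs (♯ g vs (node (k ₍ y ₎) ts))
    ♯-E-contains {g} {vs} {k = k} {y} {ts} a b mg m@(node (sub u i) _ , _) ih ihs =
      subst (Contains g vs) (sym (♯-E mg m)) (cases (zero-or-positive k (map (♯ g vs) ts)) ihs)
      where
      cases : LocallyZero k (map (♯ g vs) ts) ⊎ ∃[ z ] M (node (k ₍ z ₎) (map (♯ g vs) ts)) →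
              All FTerm ts ⊎ ContainsSome g vs (map (♯ g vs) ts) →
              Contains g vs (♯ k (map (♯ g vs) ts) (node (g ₍ y ₎) vs))
      cases (inj₁ z) _ =
        y , subst (_ ≼_) (sym (♯-zero (u , ♯s-M a mg ts (M-args m)) z (M-exchange i mg))) here
      cases (inj₂ (_ , mk)) (inj₂ (y′ , r , j , q)) with ih mk
      ... | inj₂ (_ , p) = y′ , ≼-trans (below j q) p
      cases (inj₂ (_ , mk)) (inj₁ ps) = ⊥-elim (FTerms⇒zero ts-fixed b ps (subst (λ ws → M (node _ ws)) ts-fixed mk))
        where ts-fixed = ♯s-FTerm ts mg (M-args m) ps

    -- Lexicographic induction on `Founded g vs` and the term: at k_y(ts) the founded pair drops to
    -- (k, ψ ts), so the new term g_y(vs) may be larger.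
    ♯-contains  : ∀ {g vs x} → Founded g vs → M (node (g ₍ x ₎) vs) → ∀ t → M t →
                  FTerm t ⊎ Contains g vs (♯ g vs t)
    ♯s-contain  : ∀ {g vs x n} → Founded g vs → M (node (g ₍ x ₎) vs) → (ts : Vec Term n) → All M ts →
                  All FTerm ts ⊎ ContainsSome g vs (map (♯ g vs) ts)
    ♯-contains a mg (var y) m = inj₂ (y , subst (_ ≼_) (sym (♯-var mg m)) here)
    ♯-contains a mg (node (fn h) ts) m with ♯s-contain a mg ts (M-args m)
    ... | inj₁ ps              = inj₁ (node ps)
    ... | inj₂ (y , r , i , p) = inj₂ (y , subst (_ ≼_) (sym (♯-F (M-Ω mg) m)) (below i p))
    ♯-contains {g} {vs} a@(founded preds) mg (node (k ₍ y ₎) ts) m@(node (sub _ i) _ , _) = inj₂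
      (♯-E-contains a (preds mg m) mg m
        (λ mk → ♯-contains (preds mg m) mk (node (g ₍ y ₎) vs) (M-exchange i mg))
        (♯s-contain a mg ts (M-args m)))
    ♯s-contain a mg []       []       = inj₁ []
    ♯s-contain a mg (t ∷ ts) (m ∷ ms) with ♯-contains a mg t m | ♯s-contain a mg ts ms
    ... | inj₂ (y , p) | _                    = inj₂ (y , _ , here refl , p)
    ... | inj₁ _       | inj₂ (y , r , i , p) = inj₂ (y , r , there i , p)
    ... | inj₁ p       | inj₁ ps              = inj₁ (p ∷ ps)

    -- The distributive law, for inhabited Y.

    module Inhabited {x₀} (x₀∈Y : x₀ List.∈ Y) where

      -- A rank is read off from a value of `♯`, which takes some element of `M` as last argument;
      -- `var x₀` serves.
      Ω⇒Founded : ∀ {f ls} → Ω f ls → Founded f ls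
      Ω⇒Founded ω with restricts Y U V _ _ (var x₀) ω (var x₀∈Y , variables x₀)
      ... | α , v = ranked⇒Founded α (value⇒ranked α v)

      LocallyZero⇒RankZero : ∀ {g us} → Ω g us → LocallyZero g us → RankZero L g us
      LocallyZero⇒RankZero (u , ms) z x l =
        z x₀ x₀∈Y (node (sub u x₀∈Y) (proj₁ (All.unzip ms)) , L-exchange x₀ l)

      module _ (preserves-zero : PreservesRankZero) where

        -- Lexicographic induction on `Founded f ls`, `Founded g us` and the term t.
        distributive  : ∀ {f ls g us} → Founded f ls → Ω f ls → Founded g us → Ω g us → ∀ {t} → M t →
                        ♯ f ls (♯ g us t) ≡ ♯ g (map (♯ f ls) us) (♯ f ls t)
        distributive′ : ∀ {f ls x g us y} → Founded f ls → M (node (f ₍ x ₎) ls) →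
                        Founded g us → M (node (g ₍ y ₎) us) → ∀ t → M t →
                        ♯ f ls (♯ g us t) ≡ ♯ g (map (♯ f ls) us) (♯ f ls t)
        distributives : ∀ {f ls x g us y n} → Founded f ls → M (node (f ₍ x ₎) ls) →
                        Founded g us → M (node (g ₍ y ₎) us) → (ts : Vec Term n) → All M ts →
                        map (♯ f ls) (map (♯ g us) ts) ≡ map (♯ g (map (♯ f ls) us)) (map (♯ f ls) ts)
        distributive {f} {ls} {g} {us} a ωf b ωg m with zero-or-positive f ls
        ... | inj₁ zf = begin
              ♯ f ls (♯ g us _)                    ≡⟨ ♯-zero ωf zf (♯-M b ωg m) ⟩
              ♯ g us _                             ≡⟨ cong₂ (♯ g) (♯s-zero ωf zf (proj₂ ωg)) (♯-zero ωf zf m) ⟨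
              ♯ g (map (♯ f ls) us) (♯ f ls _)    ∎
              where open ≡-Reasoning
        ... | inj₂ (_ , mf) with zero-or-positive g us
        ...   | inj₂ (_ , mg) = distributive′ a mf b mg _ m
        ...   | inj₁ zg = begin
              ♯ f ls (♯ g us _)                    ≡⟨ cong (♯ f ls) (♯-zero ωg zg m) ⟩
              ♯ f ls _                             ≡⟨ ♯-zero (proj₁ ωg , ♯s-M a mf us (proj₂ ωg)) zφ (♯-M a ωf m) ⟨
              ♯ g (map (♯ f ls) us) (♯ f ls _)    ∎
              where
              open ≡-Reasoning
              zφ : LocallyZero g (map (♯ f ls) us)
              -- The hypothesis on rank 0 enters here: g♯(φ us, ·) is the identity because g♯(us, ·)
              -- is.
              zφ x _ (_ , l) = preserves-zero f g ls us (proj₂ (All.unzip (proj₂ ωf)))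
                                 (proj₂ (All.unzip (proj₂ ωg))) (LocallyZero⇒RankZero ωg zg) x l
        distributive′ {f} {ls} {x} {g} {us} a mf b mg (var z) m@(var i , _) = begin
          ♯ f ls (♯ g us (var z))                        ≡⟨ cong (♯ f ls) (♯-var mg m) ⟩
          ♯ f ls (node (g ₍ z ₎) us)                     ≡⟨ ♯-E mf (M-exchange i mg) ⟩
          ♯ g (map (♯ f ls) us) (node (f ₍ z ₎) ls)     ≡⟨ cong (♯ g _) (♯-var mf m) ⟨
          ♯ g (map (♯ f ls) us) (♯ f ls (var z))        ∎
          where open ≡-Reasoning
        distributive′ {f} {ls} {x} {g} {us} a mf b mg (node (fn h) ts) m = begin
          ♯ f ls (♯ g us (node (fn h) ts))
            ≡⟨ cong (♯ f ls) (♯-F (M-Ω mg) m) ⟩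
          ♯ f ls (node (fn h) (map (♯ g us) ts))
            ≡⟨ ♯-F (M-Ω mf) (M-F m (♯s-M b mg ts (M-args m))) ⟩
          node (fn h) (map (♯ f ls) (map (♯ g us) ts))
            ≡⟨ cong (node (fn h)) (distributives a mf b mg ts (M-args m)) ⟩
          node (fn h) (map (♯ g φus) (map (♯ f ls) ts))
            ≡⟨ ♯-F (proj₁ (M-Ω mg) , ♯s-M a mf us (M-args mg)) (M-F m (♯s-M a mf ts (M-args m))) ⟨
          ♯ g φus (node (fn h) (map (♯ f ls) ts))
            ≡⟨ cong (♯ g φus) (♯-F (M-Ω mf) m) ⟨
          ♯ g φus (♯ f ls (node (fn h) ts)) ∎
          where
          open ≡-Reasoning
          φus = map (♯ f ls) us
        distributive′ {f} {ls} {x} {g} {us} a@(founded preds) mf b@(founded preds′) mg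
                      (node (k ₍ z ₎) ts) m@(node (sub u i) _ , _) = begin
          ♯ f ls (♯ g us (node (k ₍ z ₎) ts))
            ≡⟨ cong (♯ f ls) (♯-E mg m) ⟩
          ♯ f ls (♯ k (map (♯ g us) ts) (node (g ₍ z ₎) us))
            -- The first founded pair is kept and the second drops from (g, us) to (k, ψ ts), so the
            -- term g_z(us) is unrestricted.
            ≡⟨ distributive a (M-Ω mf) (preds′ mg m) (u , ♯s-M b mg ts (M-args m)) (M-exchange i mg) ⟩
          ♯ k (map (♯ f ls) (map (♯ g us) ts)) (♯ f ls (node (g ₍ z ₎) us))
            ≡⟨ cong₂ (♯ k) (distributives a mf b mg ts (M-args m)) (♯-E mf (M-exchange i mg)) ⟩
          ♯ k (map (♯ g φus) (map (♯ f ls) ts)) (♯ g φus (node (f ₍ z ₎) ls))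
            -- The first founded pair drops to (g, φ us), so the second may be any element of Ω,
            -- with a fresh proof of `Founded`.
            ≡⟨ distributive (preds mf mg) ωφ (Ω⇒Founded ωk) ωk (M-exchange i mf) ⟨
          ♯ g φus (♯ k (map (♯ f ls) ts) (node (f ₍ z ₎) ls))
            ≡⟨ cong (♯ g φus) (♯-E mf m) ⟨
          ♯ g φus (♯ f ls (node (k ₍ z ₎) ts)) ∎
          where
          open ≡-Reasoning
          φus = map (♯ f ls) us
          ωφ : Ω g φus
          ωφ = proj₁ (M-Ω mg) , ♯s-M a mf us (M-args mg)
          ωk : Ω k (map (♯ f ls) ts)
          ωk = u , ♯s-M a mf ts (M-args m)
        distributives a mf b mg []       []       = refl
        distributives a mf b mg (t ∷ ts) (m ∷ ms) =
          cong₂ _∷_ (distributive′ a mf b mg t m) (distributives a mf b mg ts ms)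

  -- From finite parts to L: the two implications.

  open Local

  RankZero⇒fixed : ∀ {f ls u} → All L ls → RankZero L f ls → L u → ♯ f ls u ≡ u
  RankZero⇒fixed {f} {ls} {u} Lls z Lu with finite-supports (u ∷ ls)
  ... | Y , U , V , Tu ∷ Tls =
        -- The support of u and ls need not mention f, which must be added for (f, ls) to lie in Ω.
        ♯-zero Y (f List.∷ U) V
          (ListAny.here refl , All.zip (Ts-mono id ListAny.there id Tls , Lls))
          (λ x _ (_ , l) → z x l)
          (T-mono id ListAny.there id Tu , Lu)

  RankZero⇒fixeds : ∀ {f ls n} {us : Vec Term n} → All L ls → RankZero L f ls → All L us →
                    map (♯ f ls) us ≡ us
  RankZero⇒fixeds Lls z = map-id-local ∘ All.map (RankZero⇒fixed Lls z)

  rank-zero-or-positive : ∀ f ls → RankZero L f ls ⊎ ∃[ x ] L (node (f ₍ x ₎) ls)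
  rank-zero-or-positive f ls with dec (∃[ x ] L (node (f ₍ x ₎) ls))
  ... | yes p = inj₂ p
  ... | no ¬p = inj₁ λ x l → ¬p (x , l)

  endomorphic⇒preserves : PartiallyEndomorphic L ♯ → PreservesRankZero
  endomorphic⇒preserves endo f g ls us Lls Lus z x Lv with rank-zero-or-positive f ls
  -- Here φ is the identity, so vs = us.
  ... | inj₁ zf = z x (subst (λ vs → L (node (g ₍ x ₎) vs)) (RankZero⇒fixeds Lls zf Lus) Lv)
  -- Although g_x(us) is not in `L`, its support puts g into U and makes us elements of `M`.
  ... | inj₂ (y , Lf) with finite-supports (node (f ₍ x ₎) ls ∷ node (g ₍ x ₎) us ∷ [])
  ...   | Y , U , V , Tf@(node (sub _ i) _) ∷ node (sub u _) Tus ∷ [] = contradictory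
    where
    φ = ♯ f ls
    vs = map φ us
    open IsEndomorphism (endo f ls Lls)

    mf : M Y U V (node (f ₍ x ₎) ls)
    mf = Tf , L-exchange x Lf

    mus : All (M Y U V) us
    mus = All.zip (Tus , Lus)

    founded-f = Inhabited.Ω⇒Founded Y U V i (M-Ω Y U V mf)

    ωv : Ω Y U V g vs
    ωv = u , ♯s-M Y U V founded-f mf us mus

    mv : M Y U V (node (g ₍ x ₎) vs)
    mv = node (sub u i) (proj₁ (All.unzip (proj₂ ωv))) , Lv

    fixed : node (f ₍ x ₎) ls ≡ ♯ g vs (node (f ₍ x ₎) ls)
    fixed = begin
      node (f ₍ x ₎) ls            ≡⟨ ♯-var Y U V mf (M-var Y U V mf) ⟨
      φ (var x)                    ≡⟨ cong φ (RankZero⇒fixed Lus z (variables x)) ⟨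
      φ (♯ g us (var x))           ≡⟨ preserves-♯ g us (var x) Lus (variables x) ⟩
      ♯ g vs (φ (var x))           ≡⟨ cong (♯ g vs) (♯-var Y U V mf (M-var Y U V mf)) ⟩
      ♯ g vs (node (f ₍ x ₎) ls)   ∎
      where open ≡-Reasoning

    contradictory : ⊥
    contradictory with ♯s-contain Y U V founded-f mf us mus
    -- If all us are F-terms, φ fixes them and again vs = us.
    ... | inj₁ ps = z x (subst (λ ws → L (node (g ₍ x ₎) ws)) (♯s-FTerm Y U V us mf mus ps) Lv)
    ... | inj₂ (y₁ , r , j , p)
      with ♯-contains Y U V (Inhabited.Ω⇒Founded Y U V i ωv) mv (node (f ₍ x ₎) ls) mf
    -- The entry r of vs contains f_{y₁}(ls), so size f_x(ls) ≤ `sizes vs` < size g_{y₂}(vs) ≤ size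
    -- f_x(ls).
    ...   | inj₂ (y₂ , q) = 1+n≰n (≤-trans (s≤s (≤-trans (≼⇒size≤ p) (∈⇒size≤sizes j)))
                              (≼⇒size≤ (subst (node (g ₍ y₂ ₎) vs ≼_) (sym fixed) q)))

  preserves⇒endomorphic : PreservesRankZero → PartiallyEndomorphic L ♯
  preserves⇒endomorphic preserves f ls Lls = record
    { preserves-L = λ u → closed f ls u Lls
    ; preserves-♯ = preserves-♯
    ; preserves-F = preserves-F
    }
    where
    preserves-♯ : ∀ g us u → All L us → L u → ♯ f ls (♯ g us u) ≡ ♯ g (map (♯ f ls) us) (♯ f ls u)
    preserves-♯ g us u Lus Lu with rank-zero-or-positive f ls
    ... | inj₁ z = trans (RankZero⇒fixed Lls z (closed g us u Lus Lu))
                     (sym (cong₂ (♯ g) (RankZero⇒fixeds Lls z Lus) (RankZero⇒fixed Lls z Lu)))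
    -- The term g_x(us) need not lie in `L`; it is listed to get g into U and us into `M`.
    ... | inj₂ (x , Lf) with finite-supports (node (f ₍ x ₎) ls ∷ node (g ₍ x ₎) us ∷ u ∷ [])
    ...   | Y , U , V , Tf@(node (sub _ i) _) ∷ node (sub v _) Tus ∷ Tu ∷ [] =
            distributive preserves (Ω⇒Founded ωf) ωf (Ω⇒Founded ωg) ωg (Tu , Lu)
      where
      open Inhabited Y U V i
      ωf = M-Ω Y U V (Tf , Lf)
      ωg = v , All.zip (Tus , Lus)

    preserves-F : ∀ h us → All L us → ♯ f ls (node (fn h) us) ≡ node (fn h) (map (♯ f ls) us)
    preserves-F h us Lus with rank-zero-or-positive f ls
    ... | inj₁ z = trans (RankZero⇒fixed Lls z (F-closed h us Lus))
                     (cong (node (fn h)) (sym (RankZero⇒fixeds Lls z Lus)))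
    ... | inj₂ (x , Lf) with finite-supports (node (f ₍ x ₎) ls ∷ node (fn h) us ∷ [])
    ...   | Y , U , V , Tf ∷ Th ∷ [] = ♯-F Y U V (M-Ω Y U V (Tf , Lf)) (Th , F-closed h us Lus)

theorem4p19 : ExcludedMiddle (lsuc 0ℓ) → (Sg : Signature) (X : Set) →
    let open Terms Sg X in
    (L : Pred Term 0ℓ) → Admissible L → LocallyOperable L →
    (♯ : Operations) → IsPreEndomorphicLaverTable L ♯ →
    PartiallyEndomorphic L ♯ ⇔
    (∀ (f g : E) (ls : Vec Term (arityE f)) (us : Vec Term (arityE g)) →
    All L ls → All L us →
    RankZero L g us → RankZero L g (map (♯ f ls) us))
theorem4p19 em Sg X L adm _ ♯ table = mk⇔ endomorphic⇒preserves preserves⇒endomorphic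
  where open LaverTable em Sg X L adm ♯ table
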